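{- In the unweighted online setting with $m$ identical machines, every deterministic online algorithm that satisfies EF1 has fair competitive ratio at least $2-\tfrac1m$. That is, for every $m\ge1$, every deterministic online algorithm $\mathrm{ALG}$ on $m$ machines that maintains EF1 at all times, and every $\alpha<2-\tfrac1m$, there is an instance $\mathcal I$ of unit-weight intervals such that $$|\mathrm{OPT}(\mathcal I)|\;>\;\alpha\,|\mathrm{ALG}(\mathcal I)| .$$
   Context: Setting. An instance $\mathcal I$ is a finite sequence of intervals $I_1,\dots,I_n$, each of weight $1$. Interval $I_j$ has start time $s_j$ and end time $e_j$, $s_j<e_j$, both nonnegative rationals, and is identified with $[s_j,e_j)$. Two intervals overlap (conflict) if these sets intersect. Machines are $1,\dots,m$. A schedule assigns a subset of the intervals to machines, each to exactly one machine, with no two intervals on the same machine overlapping. $\mathrm{OPT}(\mathcal I)$ is a schedule with the maximum number $|\mathrm{OPT}(\mathcal I)|$ of assigned intervals, without fairness requirement and with the whole instance known. Online model. Intervals arrive one at a time in index order, with $s_1\le s_2\le\dots\le s_n$. When $I_j$ arrives (at time $s_j$) the algorithm learns $(s_j,e_j)$ and must immediately reject it (irrevocably) or accept it and assign it to a machine, without knowledge of later intervals. An accepted interval stays on its machine unless it is revoked; it may be revoked (removed from the schedule) at any time before its end time, and a revoked interval can never be scheduled again. At every moment the currently assigned intervals must form a schedule. $S_i$ denotes the set of intervals currently assigned to machine $i$ (accepted and not revoked so far, including already completed ones). $\mathrm{ALG}(\mathcal I)$ is the final schedule, i.e. the set of intervals accepted and never revoked. EF1: for all machines $i\neq k$ with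 $S_k\ne\emptyset$ there is $I\in S_k$ with $|S_i|\ge|S_k\setminus\{I\}|$; equivalently $|S_i|$ and $|S_k|$ differ by at most one for all $i,k$. An online algorithm satisfies EF1 if this holds at all times of its execution on every instance. The fair competitive ratio of an online EF1 algorithm is the smallest $\alpha$ with $|\mathrm{OPT}(\mathcal I)|\le\alpha|\mathrm{ALG}(\mathcal I)|$ for all instances $\mathcal I$ (infinite if there is none). -}

module Defs where

open import Data.Fin using (Fin)
import Data.Fin as Fin
open import Data.Fin.Subset using (Subset; Nonempty; _∈_; _-_; ∣_∣)
open import Data.Integer using (+_)
open import Data.Maybe using (Maybe; just; nothing; is-just)
open import Data.Maybe.Properties using (≡-dec)
open import Data.Nat using (ℕ; suc)
import Data.Nat as ℕ
open import Data.Product using (_×_; ∃-syntax)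
open import Data.Rational using (ℚ; 0ℚ; _≤_; _<_; _⊔_; _/_)
open import Data.Sum using (_⊎_)
open import Data.Vec using (Vec; _∷_; lookup; map; foldr′)
open import Data.Vec.Relation.Unary.All using (All)
open import Data.Vec.Relation.Unary.Linked using (Linked)
open import Relation.Binary.PropositionalEquality using (_≡_; _≢_)
open import Relation.Nullary using (¬_; does)

private
  variable
    m n : ℕ

record Interval : Set where
  field
    start end   : ℚ
    nonnegative : 0ℚ ≤ start
    start<end   : start < end

open Interval public

-- Interval membership, for the half-open interval [start x , end x).
_∈ᴵ_ : ℚ → Interval → Set
t ∈ᴵ x = start x ≤ t × t < end x

Overlap : Interval → Interval → Set
Overlap x y = ∃[ t ] (t ∈ᴵ x × t ∈ᴵ y)

-- Instances are stored with the most recent arrival first, so the instance I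
-- extended by a newly arriving interval x is x ∷ I.
Instance : ℕ → Set
Instance n = Vec Interval n

Ordered : Instance n → Set
Ordered = Linked (λ later earlier → start earlier ≤ start later)

-- By time t all of I has arrived.
Arrived : Instance n → ℚ → Set
Arrived I t = All (λ x → start x ≤ t) I

-- The machine of each interval; nothing for an interval that is not assigned.
Assignment : ℕ → ℕ → Set
Assignment m n = Vec (Maybe (Fin m)) n

assigned : Assignment m n → Subset n
assigned = map is-just

onMachine : Assignment m n → Fin m → Subset n
onMachine σ k = map (λ a → does (≡-dec Fin._≟_ a (just k))) σ

IsSchedule : Instance n → Assignment m n → Set
IsSchedule I σ = ∀ i j k → i ≢ j → lookup σ i ≡ just k → lookup σ j ≡ just k →
                 ¬ Overlap (lookup I i) (lookup I j)

IsOptimal : Instance n → Assignment m n → Set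
IsOptimal {n} {m} I σ =
  IsSchedule I σ ×
  ((τ : Assignment m n) → IsSchedule I τ → ∣ assigned τ ∣ ℕ.≤ ∣ assigned σ ∣)

EnvyFreeUpToOne : Assignment m n → Set
EnvyFreeUpToOne σ = ∀ i k → i ≢ k → Nonempty (onMachine σ k) →
  ∃[ j ] (j ∈ onMachine σ k × ∣ onMachine σ k - j ∣ ℕ.≤ ∣ onMachine σ i ∣)

-- A deterministic strategy.  Each component depends only on the intervals that
-- have arrived, so no knowledge of later intervals is used.  Values at unordered
-- instances, or at times before the last arrival, are irrelevant.
record Strategy (m : ℕ) : Set where
  field
    -- What is assigned at time t when exactly the intervals of I have arrived and
    -- the arrival of the last one has been dealt with.
    state  : Instance n → ℚ → Assignment m n
    -- When x arrives after I, a strategy may first revoke intervals of I in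
    -- response; what then remains of I is  makeRoom I x.
    makeRoom : Instance n → Interval → Assignment m n
    -- Then x is rejected (nothing) or accepted on a machine.
    decide : Instance n → Interval → Maybe (Fin m)

  afterDecision : Instance n → Interval → Assignment m (suc n)
  afterDecision I x = decide I x ∷ makeRoom I x

  -- Occurs I σ: after the intervals of I have arrived (for the second
  -- constructor: and one more is being dealt with), σ is at some moment the
  -- current assignment of I.  Revoking and accepting are separate steps of the
  -- execution, so the assignment between the two occurs as well.
  data Occurs : {n : ℕ} → Instance n → Assignment m n → Set where
    at-time         : {I : Instance n} {t : ℚ} → Ordered I → Arrived I t →
                      Occurs I (state I t)
    before-decision : {I : Instance n} {x : Interval} → Ordered (x ∷ I) →
                      Occurs I (makeRoom I x)
    after-decision  : {I : Instance n} {x : Interval} → Ordered (x ∷ I) →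
                      Occurs (x ∷ I) (afterDecision I x)

-- At the moment t, σ turns into σ′ by revoking intervals that have not ended.
RevokesAt : ℚ → Instance n → Assignment m n → Assignment m n → Set
RevokesAt t I σ σ′ = ∀ j →
  lookup σ′ j ≡ lookup σ j ⊎ (lookup σ′ j ≡ nothing × t < end (lookup I j))

record OnlineAlgorithm (m : ℕ) : Set where
  field
    strategy : Strategy m

  open Strategy strategy public

  field
    feasible : {I : Instance n} {σ : Assignment m n} → Occurs I σ → IsSchedule I σ

    -- As long as nothing arrives, each interval keeps its status or is revoked, and
    -- an interval that is revoked is already revoked at a time u before its end.
    while-waiting : (I : Instance n) → Ordered I →
      ∀ {t t′} → Arrived I t → t ≤ t′ → ∀ j →
      lookup (state I t′) j ≡ lookup (state I t) j ⊎
      (lookup (state I t′) j ≡ nothing ×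
       ∃[ u ] (t ≤ u × u ≤ t′ × u < end (lookup I j) × lookup (state I u) j ≡ nothing))

    on-arrival : (I : Instance n) (x : Interval) → Ordered (x ∷ I) →
      RevokesAt (start x) I (state I (start x)) (makeRoom I x)

    after-arrival : (I : Instance n) (x : Interval) → Ordered (x ∷ I) →
      RevokesAt (start x) (x ∷ I) (afterDecision I x) (state (x ∷ I) (start x))

SatisfiesEF1 : OnlineAlgorithm m → Set
SatisfiesEF1 A = ∀ {n} {I : Instance n} {σ} → Occurs I σ → EnvyFreeUpToOne σ
  where open OnlineAlgorithm A

horizon : Instance n → ℚ
horizon = foldr′ (λ x h → end x ⊔ h) 0ℚ

-- At the horizon every interval of I has ended, so nothing can be revoked any
-- more and the assigned intervals are those accepted and never revoked.
ALG : OnlineAlgorithm m → Instance n → Assignment m n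
ALG A I = OnlineAlgorithm.state A I (horizon I)

size : Assignment m n → ℚ
size σ = + ∣ assigned σ ∣ / 1

module Submission where

-- The adversary presents m − 1 copies of [0,1) and then m intervals starting at
-- time 1, each ending earlier than the one before.  All 2m − 1 of them can be
-- scheduled, so the algorithm must hold more than m, and some machine b then has a
-- unit interval and a nested interval r.  Some machine a has no unit interval; by
-- EF1 it holds a nested interval q, and q arrived before r: otherwise a was empty
-- just before q while b held two intervals.  Hence r ends before q.  From the end
-- of r on, b has two completed intervals, so EF1 forbids revoking q; as long as q
-- lasts, a holds nothing else and every machine is limited to two intervals.
-- Arbitrarily many disjoint unit intervals inside q now arrive.

open import Defs
open import Data.Fin using (Fin; zero; suc; toℕ; inject₁; splitAt; _↑ˡ_; _↑ʳ_)
import Data.Fin as Fin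
import Data.Fin.Properties as Fin
open import Data.Fin.Subset using (Subset; Nonempty; _∈_; ∣_∣; ⁅_⁆; inside; outside)
  renaming (_-_ to _∖_)
import Data.Fin.Subset.Properties as Subset
open Subset using (drop-there)
open import Data.Integer using (+_)
import Data.Integer as ℤ
import Data.Integer.Properties as ℤ
open import Data.Maybe using (just; nothing)
open import Data.Maybe.Properties using (≡-dec; just-injective)
open import Data.Nat as ℕ using (ℕ; NonZero; zero; suc; z≤n; s≤s)
import Data.Nat.Properties as ℕ
open import Algebra.Properties.Monoid.Sum ℕ.+-0-monoid using (sum)
open import Data.Product using (_×_; _,_; ∃-syntax; proj₁; proj₂)
open import Data.Rational using (ℚ; 0ℚ; _≤_; _<_; _-_; _*_; _/_; *≤*; *<*)
open import Data.Rational.Literals using (fromℤ)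
import Data.Rational as ℚ
import Data.Rational.Properties as ℚ
open import Data.Sum using (_⊎_; inj₁; inj₂)
open import Data.Vec as Vec using (Vec; []; _∷_; _++_; lookup; tabulate; replicate; allFin)
import Data.Vec.Properties as Vec
open import Data.Vec.Relation.Unary.All as All using (All; []; _∷_)
import Data.Vec.Relation.Unary.All.Properties as All
open import Data.Vec.Relation.Unary.Linked using ([]; [-]; _∷_)
open import Function using (_∘_; id)
open import Relation.Binary.PropositionalEquality
  using (_≡_; _≢_; refl; sym; trans; cong; cong₂; subst; subst₂; module ≡-Reasoning)
open import Relation.Nullary using (¬_; Dec; yes; no; does; contradiction)
open import Relation.Nullary.Decidable using (dec-true)

private
  variable
    m n p : ℕ
    I : Instance n
    σ σ′ : Assignment m n
    s t : ℚ

-- Cardinalities of finite subsets.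

x∈p∧y∈p∧x≢y⇒p-z≢∅ : ∀ {P : Subset n} {x y} z → x ∈ P → y ∈ P → x ≢ y → Nonempty (P ∖ z)
x∈p∧y∈p∧x≢y⇒p-z≢∅ {x = x} {y} z x∈P y∈P x≢y with x Fin.≟ z
... | no x≢z   = x , Subset.x∈p∧x≢y⇒x∈p-y x∈P x≢z
... | yes refl = y , Subset.x∈p∧x≢y⇒x∈p-y y∈P (x≢y ∘ sym)

nonempty⇒∣p∣>0 : (P : Subset n) → Nonempty P → 0 ℕ.< ∣ P ∣
nonempty⇒∣p∣>0 P (_ , x∈P) = ℕ.≤-<-trans z≤n (Subset.x∈p⇒∣p-x∣<∣p∣ x∈P)

empty⇒∣p∣≡0 : (P : Subset n) → ¬ Nonempty P → ∣ P ∣ ≡ 0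
empty⇒∣p∣≡0 {n} P ¬P = trans (cong ∣_∣ (Subset.Empty-unique ¬P)) (Subset.∣⊥∣≡0 n)

∣p∣>0⇒nonempty : (P : Subset n) → 0 ℕ.< ∣ P ∣ → Nonempty P
∣p∣>0⇒nonempty P 0<∣P∣ with Subset.nonempty? P
... | yes P≢∅ = P≢∅
... | no P≡∅  = contradiction (empty⇒∣p∣≡0 P P≡∅) (ℕ.>⇒≢ 0<∣P∣)

p∖x⊆q⇒∣p∣≤1+∣q∣ : ∀ {P Q : Subset n} x → (∀ {y} → y ∈ P → y ≢ x → y ∈ Q) → ∣ P ∣ ℕ.≤ suc ∣ Q ∣
p∖x⊆q⇒∣p∣≤1+∣q∣ {P = u ∷ P} {v ∷ Q} zero P∖x⊆Q = begin
  ∣ u ∷ P ∣      ≤⟨ ∣x∷p∣≤1+∣p∣ u ⟩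
  suc ∣ P ∣      ≤⟨ s≤s (Subset.p⊆q⇒∣p∣≤∣q∣ λ y∈P → drop-there (P∖x⊆Q (Vec.there y∈P) (λ ()))) ⟩
  suc ∣ Q ∣      ≤⟨ s≤s (Subset.∣p∣≤∣x∷p∣ v Q) ⟩
  suc ∣ v ∷ Q ∣  ∎
  where
  open ℕ.≤-Reasoning
  ∣x∷p∣≤1+∣p∣ : ∀ u → ∣ u ∷ P ∣ ℕ.≤ suc ∣ P ∣
  ∣x∷p∣≤1+∣p∣ inside  = ℕ.≤-refl
  ∣x∷p∣≤1+∣p∣ outside = ℕ.n≤1+n _
p∖x⊆q⇒∣p∣≤1+∣q∣ {P = outside ∷ P} {v ∷ Q} (suc x) P∖x⊆Q =
  ℕ.≤-trans (p∖x⊆q⇒∣p∣≤1+∣q∣ x λ y∈P y≢x →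
              drop-there (P∖x⊆Q (Vec.there y∈P) (y≢x ∘ Fin.suc-injective)))
            (s≤s (Subset.∣p∣≤∣x∷p∣ v Q))
p∖x⊆q⇒∣p∣≤1+∣q∣ {P = inside ∷ P} {v ∷ Q} (suc x) P∖x⊆Q with P∖x⊆Q Vec.here (λ ())
... | Vec.here = s≤s (p∖x⊆q⇒∣p∣≤1+∣q∣ x λ y∈P y≢x →
        drop-there (P∖x⊆Q (Vec.there y∈P) (y≢x ∘ Fin.suc-injective)))

∣p∣≤1+∣p-x∣ : ∀ (P : Subset n) x → ∣ P ∣ ℕ.≤ suc ∣ P ∖ x ∣
∣p∣≤1+∣p-x∣ P x = p∖x⊆q⇒∣p∣≤1+∣q∣ {P = P} x Subset.x∈p∧x≢y⇒x∈p-y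

∣p∣>1⇒∃≢ : (P : Subset n) → 1 ℕ.< ∣ P ∣ → ∃[ x ] ∃[ y ] (x ∈ P × y ∈ P × x ≢ y)
∣p∣>1⇒∃≢ P 1<∣P∣ with ∣p∣>0⇒nonempty P (ℕ.<-trans (s≤s z≤n) 1<∣P∣)
... | x , x∈P with ∣p∣>0⇒nonempty (P ∖ x) (ℕ.s≤s⁻¹ (ℕ.≤-trans 1<∣P∣ (∣p∣≤1+∣p-x∣ P x)))
... | y , y∈P-x = x , y , x∈P , Subset.p─q⊆p P ⁅ x ⁆ y∈P-x , λ where
  -- If `y` were `x`, it would lie in `P ∖ x`, and removing it a second time would shrink that set;
  -- but removal is idempotent.
  refl → ℕ.<-irrefl (cong ∣_∣ (Subset.p─q─q≡p─q P ⁅ x ⁆)) (Subset.x∈p⇒∣p-x∣<∣p∣ y∈P-x)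

-- Counting assigned intervals machine by machine.

∈-onMachine⁺ : ∀ (σ : Assignment m n) {i k} → lookup σ i ≡ just k → i ∈ onMachine σ k
∈-onMachine⁺ σ {i} {k} σi≡k = Vec.lookup⇒[]= i _
  (trans (Vec.lookup-map i _ σ) (dec-true (≡-dec Fin._≟_ _ (just k)) σi≡k))

∈-onMachine⁻ : ∀ (σ : Assignment m n) {i k} → i ∈ onMachine σ k → lookup σ i ≡ just k
∈-onMachine⁻ σ {i} {k} i∈k
  with ≡-dec Fin._≟_ (lookup σ i) (just k) | trans (sym (Vec.lookup-map i _ σ)) (Vec.[]=⇒lookup i∈k)
... | yes eq | _ = eq
... | no _   | ()

sum-mono-≤ : ∀ {k} {f g : Fin k → ℕ} → (∀ i → f i ℕ.≤ g i) → sum f ℕ.≤ sum g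
sum-mono-≤ {zero}  f≤g = z≤n
sum-mono-≤ {suc k} f≤g = ℕ.+-mono-≤ (f≤g zero) (sum-mono-≤ (f≤g ∘ suc))

sum-mono-< : ∀ {k} {f g : Fin k → ℕ} → (∀ i → f i ℕ.≤ g i) → ∀ j → f j ℕ.< g j → sum f ℕ.< sum g
sum-mono-< f≤g zero    fj<gj = ℕ.+-mono-<-≤ fj<gj (sum-mono-≤ (f≤g ∘ suc))
sum-mono-< f≤g (suc j) fj<gj = ℕ.+-mono-≤-< (f≤g zero) (sum-mono-< (f≤g ∘ suc) j fj<gj)

sum-const : ∀ k c → sum {k} (λ _ → c) ≡ k ℕ.* c
sum-const zero    c = refl
sum-const (suc k) c = cong (c ℕ.+_) (sum-const k c)

∣assigned∣≤sum : (σ : Assignment m n) → ∣ assigned σ ∣ ℕ.≤ sum (λ k → ∣ onMachine σ k ∣)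
∣assigned∣≤sum []            = z≤n
∣assigned∣≤sum (nothing ∷ σ) = ∣assigned∣≤sum σ
∣assigned∣≤sum (just l ∷ σ)  = ℕ.≤-<-trans (∣assigned∣≤sum σ)
  (sum-mono-< (λ k → Subset.∣p∣≤∣x∷p∣ (does (≡-dec Fin._≟_ (just l) (just k))) (onMachine σ k)) l l<)
  where
  l< : ∣ onMachine σ l ∣ ℕ.< ∣ onMachine (just l ∷ σ) l ∣
  l< rewrite dec-true (≡-dec Fin._≟_ (just l) (just l)) refl = ℕ.≤-refl

∣assigned∣≤ : ∀ (σ : Assignment m n) {c} → (∀ k → ∣ onMachine σ k ∣ ℕ.≤ c) →
              ∣ assigned σ ∣ ℕ.≤ m ℕ.* c
∣assigned∣≤ {m} σ {c} σ≤c = ℕ.≤-trans (∣assigned∣≤sum σ)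
  (ℕ.≤-trans (sum-mono-≤ σ≤c) (ℕ.≤-reflexive (sum-const m c)))

-- Consequences of EF1 for a single assignment.

-- Whichever interval `j` EF1 removes from `b`, one of `r` and `d` stays behind, so `a` must hold
-- something to match it.
ef1⇒nonempty : ∀ {a b r d} → EnvyFreeUpToOne σ → a ≢ b → r ≢ d →
               lookup σ r ≡ just b → lookup σ d ≡ just b → ∃[ q ] (lookup σ q ≡ just a)
ef1⇒nonempty {σ = σ} {a} {b} {r} {d} ef1 a≢b r≢d σr≡b σd≡b
  with ef1 a b a≢b (r , ∈-onMachine⁺ σ σr≡b)
... | j , _ , b-j≤a with ∣p∣>0⇒nonempty (onMachine σ a) (ℕ.<-≤-trans (nonempty⇒∣p∣>0 (onMachine σ b ∖ j)
        (x∈p∧y∈p∧x≢y⇒p-z≢∅ j (∈-onMachine⁺ σ σr≡b) (∈-onMachine⁺ σ σd≡b) r≢d)) b-j≤a)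
... | q , q∈a = q , ∈-onMachine⁻ σ q∈a

-- A single machine stuck at one interval caps every machine at two. This bounds the algorithm on
-- the long instance.
ef1⇒≤2 : ∀ {a} → EnvyFreeUpToOne σ → ∣ onMachine σ a ∣ ℕ.≤ 1 → ∀ k → ∣ onMachine σ k ∣ ℕ.≤ 2
ef1⇒≤2 {σ = σ} {a} ef1 a≤1 k with a Fin.≟ k | Subset.nonempty? (onMachine σ k)
... | yes refl | _      = ℕ.≤-trans a≤1 (ℕ.n≤1+n 1)
... | no _     | no k≡∅ = ℕ.≤-trans (ℕ.≤-reflexive (empty⇒∣p∣≡0 _ k≡∅)) z≤n
... | no a≢k   | yes k≢∅ with ef1 a k a≢k k≢∅
...   | j , _ , k-j≤a =
        ℕ.≤-trans (∣p∣≤1+∣p-x∣ (onMachine σ k) j) (s≤s (ℕ.≤-trans k-j≤a a≤1))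

onlyOne⇒≤1 : ∀ {a} q → (∀ j → lookup σ j ≡ just a → j ≡ q) → ∣ onMachine σ a ∣ ℕ.≤ 1
onlyOne⇒≤1 {σ = σ} q only = ℕ.≤-trans
  (Subset.p⊆q⇒∣p∣≤∣q∣ λ j∈a →
    subst (_∈ ⁅ q ⁆) (sym (only _ (∈-onMachine⁻ σ j∈a))) (Subset.x∈⁅x⁆ q))
  (ℕ.≤-reflexive (Subset.∣⁅x⁆∣≡1 q))

-- Schedules that assign every interval.

Compatible : Instance n → Vec (Fin m) n → Set
Compatible I f = ∀ i j → i ≢ j → lookup f i ≡ lookup f j → ¬ Overlap (lookup I i) (lookup I j)

∣assigned∣-map-just : (f : Vec (Fin m) n) → ∣ assigned (Vec.map just f) ∣ ≡ n
∣assigned∣-map-just []      = refl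
∣assigned∣-map-just (_ ∷ f) = cong suc (∣assigned∣-map-just f)

-- Both adversarial instances can be scheduled completely, so optimality needs no comparison
-- argument: no assignment has more than `n` intervals.
compatible⇒optimal : (f : Vec (Fin m) n) → Compatible I f → IsOptimal I (Vec.map just f)
compatible⇒optimal f compatible =
  (λ i j k i≢j fi≡k fj≡k → compatible i j i≢j (just-injective
    (trans (trans (sym (Vec.lookup-map i just f)) fi≡k)
           (trans (sym fj≡k) (Vec.lookup-map j just f))))) ,
  λ τ _ → ℕ.≤-trans (Subset.∣p∣≤n (assigned τ)) (ℕ.≤-reflexive (sym (∣assigned∣-map-just f)))

disjoint : ∀ x y → end x ≤ start y → ¬ Overlap x y
disjoint _ _ ex≤sy (t , (_ , t<ex) , (sy≤t , _)) =
  ℚ.<-irrefl refl (ℚ.<-≤-trans t<ex (ℚ.≤-trans ex≤sy sy≤t))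

overlap-sym : ∀ x y → Overlap x y → Overlap y x
overlap-sym _ _ (t , t∈x , t∈y) = t , t∈y , t∈x

compatible-∷ : ∀ {x k} {f : Vec (Fin m) n} → Compatible I f →
               (∀ j → lookup f j ≡ k → end (lookup I j) ≤ start x) → Compatible (x ∷ I) (k ∷ f)
compatible-∷ f-ok ended zero zero i≢j _ = contradiction refl i≢j
compatible-∷ {I = I} {x} f-ok ended zero (suc j) _ k≡fj =
  disjoint (lookup I j) x (ended j (sym k≡fj)) ∘ overlap-sym x (lookup I j)
compatible-∷ {I = I} {x} f-ok ended (suc i) zero _ fi≡k = disjoint (lookup I i) x (ended i fi≡k)
compatible-∷ f-ok ended (suc i) (suc j) i≢j fi≡fj = f-ok i j (i≢j ∘ cong suc) fi≡fj

-- Arrival order and the horizon.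

ordered-tail : ∀ {x} → Ordered (x ∷ I) → Ordered I
ordered-tail [-]     = []
ordered-tail (_ ∷ o) = o

ordered⇒arrived : ∀ {x} → Ordered (x ∷ I) → Arrived I (start x)
ordered⇒arrived [-]                          = []
ordered⇒arrived {I = _ ∷ _} (y≤x ∷ ordered) =
  y≤x ∷ All.map (λ z≤y → ℚ.≤-trans z≤y y≤x) (ordered⇒arrived ordered)

ordered-∷ : ∀ {x} → Ordered I → Arrived I (start x) → Ordered (x ∷ I)
ordered-∷ {I = []}    _       _         = [-]
ordered-∷ {I = _ ∷ _} ordered (y≤x ∷ _) = y≤x ∷ ordered

ordered-++ : (X : Instance p) → All (λ x → start x ≡ t) X →
             Ordered I → Arrived I t → Ordered (X ++ I)
ordered-++ []      []             ordered _       = ordered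
ordered-++ (x ∷ X) (refl ∷ X≡t) ordered arrived = ordered-∷ (ordered-++ X X≡t ordered arrived)
  (All.++⁺ (All.map ℚ.≤-reflexive X≡t) arrived)

ended-at-horizon : (I : Instance n) → All (λ x → end x ≤ horizon I) I
ended-at-horizon []      = []
ended-at-horizon (x ∷ I) = ℚ.p≤p⊔q _ _ ∷
  All.map (λ e≤h → ℚ.≤-trans e≤h (ℚ.p≤q⊔p (end x) (horizon I))) (ended-at-horizon I)

arrived-at-horizon : (I : Instance n) → Arrived I (horizon I)
arrived-at-horizon I = All.map (λ {x} → ℚ.≤-trans (ℚ.<⇒≤ (start<end x))) (ended-at-horizon I)

-- Revocation steps and the two invariants.

-- Revoking only removes, so facts about assigned intervals pass backwards in time. For ended
-- intervals, `revokes-keep` transfers the status in both directions.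
revokes-back : RevokesAt t I σ σ′ → ∀ {j k} → lookup σ′ j ≡ just k → lookup σ j ≡ just k
revokes-back ρ {j} σ′j≡k with ρ j
... | inj₁ σ′j≡σj         = trans (sym σ′j≡σj) σ′j≡k
... | inj₂ (σ′j≡none , _) = contradiction (trans (sym σ′j≡none) σ′j≡k) λ ()

revokes-keep : RevokesAt t I σ σ′ → ∀ {j} → end (lookup I j) ≤ t → lookup σ′ j ≡ lookup σ j
revokes-keep ρ {j} ended with ρ j
... | inj₁ σ′j≡σj  = σ′j≡σj
... | inj₂ (_ , t<e) = contradiction (ℚ.<-≤-trans t<e ended) (ℚ.<-irrefl refl)

-- Positions count back from the most recent arrival, so r Fin.< q says that r
-- arrived after q.
record StackedAt (T : ℚ) (I : Instance n) (σ : Assignment m n) : Set where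
  constructor stacked
  field
    later : ∀ {q r d a b} → T ∈ᴵ lookup I q → T ∈ᴵ lookup I r → end (lookup I d) ≤ T →
            lookup σ q ≡ just a → lookup σ r ≡ just b → lookup σ d ≡ just b →
            (∀ j → end (lookup I j) ≤ T → lookup σ j ≢ just a) → r Fin.< q

-- The positive hypotheses pass back to `σ` because revoking only removes. The negative one, that
-- `a` has no interval ended by `T`, passes back because such an interval can no longer be revoked
-- at `t`.
stacked-revoke : ∀ {T} (σ : Assignment m n) → T ≤ t → RevokesAt t I σ σ′ →
                 StackedAt T I σ → StackedAt T I σ′
stacked-revoke {I = I} {σ′ = σ′} σ T≤t ρ (stacked later) =
  stacked λ q∈ r∈ d-ended σ′q≡a σ′r≡b σ′d≡b none →
    later q∈ r∈ d-ended (back σ′q≡a) (back σ′r≡b) (back σ′d≡b) λ j ended σj≡a →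
      none j ended (trans (revokes-keep {I = I} {σ = σ} {σ′ = σ′} ρ (ℚ.≤-trans ended T≤t)) σj≡a)
  where
  back : ∀ {j k} → lookup σ′ j ≡ just k → lookup σ j ≡ just k
  back = revokes-back {I = I} {σ = σ} {σ′ = σ′} ρ

-- Under EF1, Q can no longer be revoked: a would be left empty against the two
-- completed intervals of b.
record Blocked (e : ℚ) (Q : Interval) (a : Fin m) (I : Instance n) (σ : Assignment m n) : Set where
  field
    {q r d} : Fin n
    {b}     : Fin m
    a≢b     : a ≢ b
    r≢d     : r ≢ d
    Iq≡Q    : lookup I q ≡ Q
    r-ended : end (lookup I r) ≤ e
    d-ended : end (lookup I d) ≤ e
    σq≡a    : lookup σ q ≡ just a
    σr≡b    : lookup σ r ≡ just b
    σd≡b    : lookup σ d ≡ just b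
    only-q  : ∀ j → lookup σ j ≡ just a → j ≡ q

-- `r` and `d` have ended by `e`, hence survive on `b`. EF1 for `σ′` then demands some interval on
-- `a`, and only `q` is available.
blocked-revoke : ∀ {e Q a} (σ : Assignment m n) → EnvyFreeUpToOne σ′ → e ≤ t →
                 RevokesAt t I σ σ′ → Blocked e Q a I σ → Blocked e Q a I σ′
blocked-revoke {σ′ = σ′} {I = I} {a = a} σ ef1 e≤t ρ B = record
  { a≢b = a≢b ; r≢d = r≢d ; Iq≡Q = Iq≡Q ; r-ended = r-ended ; d-ended = d-ended
  ; σq≡a = σ′q≡a ; σr≡b = σ′r≡b ; σd≡b = σ′d≡b
  ; only-q = λ j σ′j≡a → only-q j (revokes-back {I = I} {σ = σ} {σ′ = σ′} ρ σ′j≡a)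
  }
  where
  open Blocked B
  σ′r≡b = trans (revokes-keep {I = I} {σ = σ} {σ′ = σ′} ρ (ℚ.≤-trans r-ended e≤t)) σr≡b
  σ′d≡b = trans (revokes-keep {I = I} {σ = σ} {σ′ = σ′} ρ (ℚ.≤-trans d-ended e≤t)) σd≡b
  σ′q≡a : lookup σ′ q ≡ just a
  σ′q≡a with ef1⇒nonempty {σ = σ′} ef1 a≢b r≢d σ′r≡b σ′d≡b
  ... | j , σ′j≡a with only-q j (revokes-back {I = I} {σ = σ} {σ′ = σ′} ρ σ′j≡a)
  ... | refl = σ′j≡a

-- The invariants along an execution.

module _ (A : OnlineAlgorithm m) (ef1 : SatisfiesEF1 A) where
  open OnlineAlgorithm A

  -- An interval lost during the wait is revoked at some `u` with `s ≤ u` and `u` before its end, so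
  -- its end lies after `s`. The whole wait can thus be treated as one revocation at the moment `s`.
  waiting : Ordered I → Arrived I s → s ≤ t → RevokesAt s I (state I s) (state I t)
  waiting {I = I} ordered arrived s≤t j with while-waiting I ordered arrived s≤t j
  ... | inj₁ kept = inj₁ kept
  ... | inj₂ (revoked , u , s≤u , _ , u<end , _) = inj₂ (revoked , ℚ.≤-<-trans s≤u u<end)

  -- The newcomer `x` runs at `T`, so it may be `q` or `r` but not `d`. As `r` alone it is the
  -- latest arrival, as claimed. As `q` it is ruled out by EF1 at the moment between making room and
  -- deciding.
  stacked-accept : ∀ {T x} → Ordered (x ∷ I) → T ∈ᴵ x → All (λ y → end y ≤ T ⊎ T ∈ᴵ y) I →
                   StackedAt T I (makeRoom I x) → StackedAt T (x ∷ I) (afterDecision I x)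
  stacked-accept {I = I} {T} {x} ordered T∈x ages (stacked later) =
    stacked λ {_} {_} {d} → later′ {d = d}
    where
    later′ : ∀ {q r d a b} → T ∈ᴵ lookup (x ∷ I) q → T ∈ᴵ lookup (x ∷ I) r →
             end (lookup (x ∷ I) d) ≤ T → lookup (afterDecision I x) q ≡ just a →
             lookup (afterDecision I x) r ≡ just b → lookup (afterDecision I x) d ≡ just b →
             (∀ j → end (lookup (x ∷ I) j) ≤ T → lookup (afterDecision I x) j ≢ just a) → r Fin.< q
    later′ {d = zero} _ _ d-ended _ _ _ _ =
      contradiction (ℚ.<-≤-trans (proj₂ T∈x) d-ended) (ℚ.<-irrefl refl)
    -- If `x` were both `q` and `r`, then `a` and `b` would coincide and `d` would be an ended
    -- interval on `a`.
    later′ {zero} {zero} {suc d} _ _ d-ended σq≡a σr≡b σd≡b none =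
      contradiction (trans σd≡b (trans (sym σr≡b) σq≡a)) (none (suc d) d-ended)
    -- Machine a can take x only if it is empty, which EF1 forbids as b holds two intervals.
    later′ {zero} {suc r} {suc d} {a} {b} _ r∈ d-ended σq≡a σr≡b σd≡b none
      with ef1⇒nonempty {σ = makeRoom I x} (ef1 (before-decision ordered)) a≢b r≢d σr≡b σd≡b
      where
      a≢b : a ≢ b
      a≢b refl = none (suc d) d-ended σd≡b
      r≢d : r ≢ d
      r≢d refl = ℚ.<-irrefl refl (ℚ.<-≤-trans (proj₂ r∈) d-ended)
    ... | j , σj≡a with All.lookup⁺ ages j
    ...   | inj₁ j-ended = contradiction σj≡a (none (suc j) j-ended)
    ...   | inj₂ T∈j     = contradiction (T , T∈x , T∈j)
                             (feasible (after-decision ordered) zero (suc j) _ (λ ()) σq≡a σj≡a)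
    later′ {suc q} {zero}  {suc d} _ _ _ _ _ _ _ = s≤s z≤n
    later′ {suc q} {suc r} {suc d} q∈ r∈ d-ended σq≡a σr≡b σd≡b none =
      s≤s (later q∈ r∈ d-ended σq≡a σr≡b σd≡b (none ∘ suc))

  -- Induction over the arrivals at `T`; each one passes through revocations, the decision, further
  -- revocations and a wait. At the start the invariant is vacuous, since nothing in `D` runs at
  -- `T`.
  stacked-state : ∀ {T} (E : Instance n) {D : Instance p} →
                  All (λ x → start x ≡ T) E → All (λ x → end x ≤ T) D → Ordered (E ++ D) →
                  ∀ {t} → T ≤ t → StackedAt T (E ++ D) (state (E ++ D) t)
  stacked-state [] _ D-ended ordered _ = stacked λ {q} q∈ _ _ _ _ _ _ →
    contradiction (ℚ.<-≤-trans (proj₂ q∈) (All.lookup⁺ D-ended q)) (ℚ.<-irrefl refl)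
  stacked-state (x ∷ E) {D} (refl ∷ E≡T) D-ended ordered T≤t =
    stacked-revoke (state (x ∷ E ++ D) (start x)) ℚ.≤-refl
      (waiting ordered (ℚ.≤-refl ∷ ordered⇒arrived ordered) T≤t)
      (stacked-revoke (afterDecision (E ++ D) x) ℚ.≤-refl (after-arrival (E ++ D) x ordered)
        (stacked-accept ordered (ℚ.≤-refl , start<end x) ages
          (stacked-revoke (state (E ++ D) (start x)) ℚ.≤-refl (on-arrival (E ++ D) x ordered)
            (stacked-state E E≡T D-ended (ordered-tail ordered) ℚ.≤-refl))))
    where
    ages : All (λ y → end y ≤ start x ⊎ start x ∈ᴵ y) (E ++ D)
    ages = All.++⁺
      (All.map (λ {y} y≡T → inj₂ (ℚ.≤-reflexive y≡T , subst (_< end y) y≡T (start<end y))) E≡T)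
      (All.map inj₁ D-ended)

  -- `x` conflicts with `Q`, which occupies `a`, so feasibility keeps `x` off that machine.
  blocked-accept : ∀ {e Q a x} → Ordered (x ∷ I) → Overlap x Q →
                   Blocked e Q a I (makeRoom I x) → Blocked e Q a (x ∷ I) (afterDecision I x)
  blocked-accept {I = I} {Q = Q} {a} {x} ordered x∩Q B = record
    { a≢b = a≢b ; r≢d = r≢d ∘ Fin.suc-injective ; Iq≡Q = Iq≡Q ; r-ended = r-ended ; d-ended = d-ended
    ; σq≡a = σq≡a ; σr≡b = σr≡b ; σd≡b = σd≡b
    ; only-q = only-sucq
    }
    where
    open Blocked B
    only-sucq : ∀ j → lookup (afterDecision I x) j ≡ just a → j ≡ suc q
    only-sucq zero    σj≡a = contradiction (subst (Overlap x) (sym Iq≡Q) x∩Q)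
      (feasible (after-decision ordered) zero (suc q) _ (λ ()) σj≡a σq≡a)
    only-sucq (suc j) σj≡a = cong suc (only-q j σj≡a)

  -- The phases are those of `stacked-state`, starting from the assignment at `e`. Every arrival
  -- comes at `e` or later, when `r` and `d` can no longer be revoked, and EF1 is invoked after each
  -- round of revocations to retain `q`.
  blocked-state : ∀ {e Q a} (X : Instance p) → Ordered (X ++ I) → Arrived I e →
                  All (λ x → e ≤ start x × Overlap x Q) X → Blocked e Q a I (state I e) →
                  ∀ {t} → e ≤ t → Arrived (X ++ I) t → Blocked e Q a (X ++ I) (state (X ++ I) t)
  blocked-state {I = I} {e = e} [] ordered arrived [] B e≤t arrived-t =
    blocked-revoke (state I e) (ef1 (at-time ordered arrived-t)) ℚ.≤-refl
      (waiting ordered arrived e≤t) B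
  blocked-state {I = I} (x ∷ X) ordered arrived ((e≤x , x∩Q) ∷ X-ok) B e≤t (x≤t ∷ arrived-t) =
    blocked-revoke (state (x ∷ X ++ I) (start x)) (ef1 (at-time ordered (x≤t ∷ arrived-t))) e≤x
      (waiting ordered (ℚ.≤-refl ∷ arrived-x) x≤t)
      (blocked-revoke (afterDecision (X ++ I) x)
        (ef1 (at-time ordered (ℚ.≤-refl ∷ arrived-x))) e≤x (after-arrival (X ++ I) x ordered)
        (blocked-accept ordered x∩Q
          (blocked-revoke (state (X ++ I) (start x)) (ef1 (before-decision ordered)) e≤x
            (on-arrival (X ++ I) x ordered)
            (blocked-state X (ordered-tail ordered) arrived X-ok B e≤x arrived-x))))
    where
    arrived-x = ordered⇒arrived ordered

-- Rational arithmetic for the ratio.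

-- With `fromℤ` the numerator and denominator are visible by computation, without reduction by a
-- gcd; `k/1≡fromℕ` connects this form with `size`.
fromℕ : ℕ → ℚ
fromℕ k = fromℤ (+ k)

fromℕ-mono-≤ : ∀ {j k} → j ℕ.≤ k → fromℕ j ≤ fromℕ k
fromℕ-mono-≤ j≤k = *≤* (ℤ.*-monoʳ-≤-nonNeg (+ 1) (ℤ.+≤+ j≤k))

fromℕ-mono-< : ∀ {j k} → j ℕ.< k → fromℕ j < fromℕ k
fromℕ-mono-< j<k = *<* (ℤ.*-monoʳ-<-pos (+ 1) (ℤ.+<+ j<k))

k/1≡fromℕ : ∀ k → + k / 1 ≡ fromℕ k
k/1≡fromℕ k = ℚ.↥p/↧p≡p (fromℕ k)

fromℕ-+ : ∀ j k → fromℕ (j ℕ.+ k) ≡ fromℕ j ℚ.+ fromℕ k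
fromℕ-+ j k = sym (trans
  (ℚ./-cong {q₁ = 1} (cong₂ ℤ._+_ (ℤ.*-identityʳ (+ j)) (ℤ.*-identityʳ (+ k))) refl)
  (k/1≡fromℕ (j ℕ.+ k)))

2x≡x+x : ∀ x → (+ 2 / 1) * x ≡ x ℚ.+ x
2x≡x+x x = trans (ℚ.*-distribʳ-+ x ℚ.1ℚ ℚ.1ℚ) (cong₂ ℚ._+_ (ℚ.*-identityˡ x) (ℚ.*-identityˡ x))

[2-i]x≡x+y : ∀ i x y → i * x ≡ ℚ.1ℚ → x ≡ ℚ.1ℚ ℚ.+ y → ((+ 2 / 1) - i) * x ≡ x ℚ.+ y
[2-i]x≡x+y i x y ix≡1 x≡1+y = begin
  ((+ 2 / 1) - i) * x              ≡⟨ ℚ.*-distribʳ-+ x (+ 2 / 1) (ℚ.- i) ⟩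
  (+ 2 / 1) * x ℚ.+ ℚ.- i * x      ≡⟨ cong₂ ℚ._+_ (2x≡x+x x) (sym (ℚ.neg-distribˡ-* i x)) ⟩
  x ℚ.+ x - i * x                  ≡⟨ cong (x ℚ.+ x -_) ix≡1 ⟩
  x ℚ.+ x - ℚ.1ℚ                   ≡⟨ cong (λ z → x ℚ.+ z - ℚ.1ℚ) (trans x≡1+y (ℚ.+-comm ℚ.1ℚ y)) ⟩
  x ℚ.+ (y ℚ.+ ℚ.1ℚ) - ℚ.1ℚ        ≡⟨ ℚ.+-assoc x (y ℚ.+ ℚ.1ℚ) (ℚ.- ℚ.1ℚ) ⟩
  x ℚ.+ (y ℚ.+ ℚ.1ℚ - ℚ.1ℚ)        ≡⟨ cong (x ℚ.+_) (ℚ.+-assoc y ℚ.1ℚ (ℚ.- ℚ.1ℚ)) ⟩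
  x ℚ.+ (y ℚ.+ 0ℚ)                 ≡⟨ cong (x ℚ.+_) (ℚ.+-identityʳ y) ⟩
  x ℚ.+ y                          ∎
  where open ≡-Reasoning

-- Here `suc m` is the number of machines, so `suc m + m` is twice that number minus one.
[2-1/m]m≡2m-1 : ∀ m → ((+ 2 / 1) - (+ 1 / suc m)) * fromℕ (suc m) ≡ fromℕ (suc m ℕ.+ m)
[2-1/m]m≡2m-1 m = trans
  ([2-i]x≡x+y (+ 1 / suc m) (fromℕ (suc m)) (fromℕ m) 1/m*m≡1 (fromℕ-+ 1 m))
  (sym (fromℕ-+ (suc m) m))
  where
  1/m*m≡1 : (+ 1 / suc m) * fromℕ (suc m) ≡ ℚ.1ℚ
  1/m*m≡1 = trans (cong (_* fromℕ (suc m)) (ℚ.↥p/↧p≡p (ℚ.1/ fromℕ (suc m))))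
    (ℚ.*-inverseˡ (fromℕ (suc m)))

p-q<p : ∀ p q → 0ℚ < q → p - q < p
p-q<p p q 0<q = subst (p - q <_) (ℚ.+-identityʳ p) (ℚ.+-monoʳ-< p (ℚ.neg-antimono-< 0<q))

α*k<2m-1 : ∀ {α m k} → α < (+ 2 / 1) - (+ 1 / suc m) → k ℕ.≤ suc m →
           α * fromℕ k < fromℕ (suc m ℕ.+ m)
-- `α` may be negative, and `k ≤ suc m` can be multiplied by `α` only if it is nonnegative;
-- otherwise the left side is at most zero.
α*k<2m-1 {α} {m} {k} α<β k≤m with α ℚ.≤? 0ℚ
... | yes α≤0 = begin-strict
  α * fromℕ k          ≤⟨ ℚ.*-monoʳ-≤-nonNeg (fromℕ k) α≤0 ⟩
  0ℚ * fromℕ k         ≡⟨ ℚ.*-zeroˡ (fromℕ k) ⟩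
  0ℚ                   <⟨ fromℕ-mono-< {0} (s≤s z≤n) ⟩
  fromℕ (suc m ℕ.+ m)  ∎
  where open ℚ.≤-Reasoning
... | no α≰0 = begin-strict
  α * fromℕ k          ≤⟨ ℚ.*-monoˡ-≤-nonNeg α {{ℚ.nonNegative (ℚ.<⇒≤ (ℚ.≰⇒> α≰0))}} (fromℕ-mono-≤ k≤m) ⟩
  α * fromℕ (suc m)    <⟨ ℚ.*-monoˡ-<-pos (fromℕ (suc m)) α<β ⟩
  _                    ≡⟨ [2-1/m]m≡2m-1 m ⟩
  fromℕ (suc m ℕ.+ m)  ∎
  where open ℚ.≤-Reasoning

α*k<n : ∀ {α m k n} → α < (+ 2 / 1) - (+ 1 / suc m) → k ℕ.+ k ℕ.< n → α * fromℕ k < fromℕ n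
α*k<n {α} {m} {k} {n} α<β 2k<n = begin-strict
  α * fromℕ k              ≤⟨ ℚ.*-monoʳ-≤-nonNeg (fromℕ k) (ℚ.<⇒≤ (ℚ.<-trans α<β 2-1/m<2)) ⟩
  (+ 2 / 1) * fromℕ k      ≡⟨ 2x≡x+x (fromℕ k) ⟩
  fromℕ k ℚ.+ fromℕ k      ≡⟨ fromℕ-+ k k ⟨
  fromℕ (k ℕ.+ k)          <⟨ fromℕ-mono-< 2k<n ⟩
  fromℕ n                  ∎
  where
  open ℚ.≤-Reasoning
  2-1/m<2 : (+ 2 / 1) - (+ 1 / suc m) < + 2 / 1
  2-1/m<2 = p-q<p (+ 2 / 1) (+ 1 / suc m) (ℚ.positive⁻¹ (+ 1 / suc m) {{ℚ.normalize-pos 1 (suc m)}})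

-- The adversary's instances.

interval : ∀ j k → j ℕ.< k → Interval
interval j k j<k = record
  { start = fromℕ j ; end = fromℕ k ; nonnegative = fromℕ-mono-≤ {0} z≤n ; start<end = fromℕ-mono-< j<k }

unit : ℕ → Interval
unit j = interval j (suc j) ℕ.≤-refl

module Adversary (m′ : ℕ) where
  private
    M = suc m′
    -- The number of final unit intervals: enough for OPT > 2·(2m) ≥ 2|ALG|.
    N = M ℕ.* 4
    T = fromℕ 1

  -- i counts back from the last of the nested intervals, which is the shortest.
  nestEnd : ℕ → ℕ
  nestEnd i = 1 ℕ.+ suc i ℕ.* N

  nested : ℕ → Interval
  nested i = interval 1 (nestEnd i) (s≤s (s≤s z≤n))

  T∈nested : ∀ i → T ∈ᴵ nested i
  T∈nested i = ℚ.≤-refl , start<end (nested i)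

  nests : Instance M
  nests = tabulate (nested ∘ toℕ)

  units : Instance m′
  units = replicate m′ (unit 0)

  base : Instance (M ℕ.+ m′)
  base = nests ++ units

  lookup-nest : ∀ i → lookup base (i ↑ˡ m′) ≡ nested (toℕ i)
  lookup-nest i = trans (Vec.lookup-++ˡ nests units i) (Vec.lookup∘tabulate (nested ∘ toℕ) i)

  lookup-unit : ∀ i → lookup base (M ↑ʳ i) ≡ unit 0
  lookup-unit i = trans (Vec.lookup-++ʳ nests units i) (Vec.lookup-replicate i (unit 0))

  -- A view of the positions of `base`: matching on `index j` replaces `j` by an explicit injection,
  -- on which the lookup lemmas apply.
  data Index : Fin (M ℕ.+ m′) → Set where
    onNest : ∀ i → Index (i ↑ˡ m′)
    onUnit : ∀ i → Index (M ↑ʳ i)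

  index : ∀ j → Index j
  index j with splitAt M j in eq
  ... | inj₁ i = subst Index (Fin.splitAt⁻¹-↑ˡ eq) (onNest i)
  ... | inj₂ i = subst Index (Fin.splitAt⁻¹-↑ʳ eq) (onUnit i)

  nest≢unit : ∀ i j → i ↑ˡ m′ ≢ M ↑ʳ j
  nest≢unit i j eq
    with trans (sym (Fin.splitAt-↑ˡ M i m′)) (trans (cong (splitAt M) eq) (Fin.splitAt-↑ʳ M m′ j))
  ... | ()

  nests-overlap : ∀ i j → Overlap (lookup base (i ↑ˡ m′)) (lookup base (j ↑ˡ m′))
  nests-overlap i j rewrite lookup-nest i | lookup-nest j = T , T∈nested (toℕ i) , T∈nested (toℕ j)

  units-overlap : ∀ i j → Overlap (lookup base (M ↑ʳ i)) (lookup base (M ↑ʳ j))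
  units-overlap i j rewrite lookup-unit i | lookup-unit j = 0ℚ , 0∈ , 0∈
    where
    0∈ : 0ℚ ∈ᴵ unit 0
    0∈ = ℚ.≤-refl , start<end (unit 0)

  unit-ended : ∀ i → end (lookup base (M ↑ʳ i)) ≤ T
  unit-ended i = ℚ.≤-reflexive (cong end (lookup-unit i))

  nests-start : All (λ x → start x ≡ T) nests
  nests-start = All.tabulate⁺ {f = nested ∘ toℕ} λ _ → refl

  units-end : All (λ x → end x ≤ T) units
  units-end = All.lookup⁻ λ i → ℚ.≤-reflexive (cong end (Vec.lookup-replicate i (unit 0)))

  arrived-T : Arrived base T
  arrived-T = All.++⁺ (All.map ℚ.≤-reflexive nests-start)
    (All.map (λ {x} → ℚ.≤-trans (ℚ.<⇒≤ (start<end x))) units-end)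

  arrived : T ≤ t → Arrived base t
  arrived T≤t = All.map (λ x≤T → ℚ.≤-trans x≤T T≤t) arrived-T

  ordered : Ordered base
  ordered = ordered-++ nests nests-start ordered-units
    (All.map (λ {x} → ℚ.≤-trans (ℚ.<⇒≤ (start<end x))) units-end)
    where
    ordered-replicate : ∀ k → Ordered (replicate k (unit 0))
    ordered-replicate zero          = []
    ordered-replicate (suc zero)    = [-]
    ordered-replicate (suc (suc k)) = ℚ.≤-refl ∷ ordered-replicate (suc k)
    ordered-units = ordered-replicate m′

  T≤horizon : T ≤ horizon base
  T≤horizon = All.head (arrived-at-horizon base)

  plan : Vec (Fin M) (M ℕ.+ m′)
  plan = allFin M ++ tabulate inject₁

  plan-nest : ∀ i → lookup plan (i ↑ˡ m′) ≡ i
  plan-nest i = trans (Vec.lookup-++ˡ (allFin M) (tabulate inject₁) i) (Vec.lookup∘tabulate id i)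

  plan-unit : ∀ i → lookup plan (M ↑ʳ i) ≡ inject₁ i
  plan-unit i = trans (Vec.lookup-++ʳ (allFin M) (tabulate inject₁) i) (Vec.lookup∘tabulate inject₁ i)

  -- Nested intervals lie on distinct machines, and so do unit intervals. A mixed pair is disjoint
  -- because the unit interval ends at 1, exactly where the nested one starts.
  plan-compatible : Compatible base plan
  plan-compatible j k j≢k same with index j | index k
  ... | onNest i | onNest l = contradiction
    (cong (_↑ˡ m′) (trans (sym (plan-nest i)) (trans same (plan-nest l)))) j≢k
  ... | onUnit i | onUnit l = contradiction
    (cong (M ↑ʳ_) (Fin.inject₁-injective (trans (sym (plan-unit i)) (trans same (plan-unit l))))) j≢k
  ... | onNest i | onUnit l rewrite lookup-nest i | lookup-unit l =
    disjoint (unit 0) (nested (toℕ i)) ℚ.≤-refl ∘ overlap-sym (nested (toℕ i)) (unit 0)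
  ... | onUnit i | onNest l rewrite lookup-unit i | lookup-nest l =
    disjoint (unit 0) (nested (toℕ l)) ℚ.≤-refl

  short : ℕ → (k : ℕ) → Instance k
  short c zero    = []
  short c (suc k) = unit (c ℕ.+ k) ∷ short c k

  module _ (r : Fin M) where
    private
      -- The short intervals begin exactly when nested interval `r` ends.
      c = nestEnd (toℕ r)
      e = fromℕ c

    full : (k : ℕ) → Instance (k ℕ.+ (M ℕ.+ m′))
    full k = short c k ++ base

    full-arrived : ∀ k → Arrived (full k) (fromℕ (c ℕ.+ k))
    full-arrived zero    = arrived (fromℕ-mono-≤ (s≤s z≤n))
    full-arrived (suc k) = fromℕ-mono-≤ (ℕ.+-monoʳ-≤ c (ℕ.n≤1+n k)) ∷
      All.map (λ x≤ → ℚ.≤-trans x≤ (fromℕ-mono-≤ (ℕ.+-monoʳ-≤ c (ℕ.n≤1+n k)))) (full-arrived k)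

    full-ordered : ∀ k → Ordered (full k)
    full-ordered zero    = ordered
    full-ordered (suc k) = ordered-∷ (full-ordered k) (full-arrived k)

    -- Consecutive nested intervals end `N` apart, so a `q` that arrived before `r` outlasts it by
    -- at least `N`. That leaves room for `N` unit intervals starting from the end of `r`.
    short-inside : ∀ {q : Fin M} → r Fin.< q → ∀ k → k ℕ.≤ N →
                   All (λ x → e ≤ start x × Overlap x (nested (toℕ q))) (short c k)
    short-inside r<q zero    _   = []
    short-inside {q} r<q (suc k) k<N =
      ( fromℕ-mono-≤ (ℕ.m≤m+n c k)
      , fromℕ (c ℕ.+ k)
      , (ℚ.≤-refl , start<end (unit (c ℕ.+ k)))
      , fromℕ-mono-≤ (s≤s z≤n)
      , fromℕ-mono-< c+k<end
      ) ∷ short-inside r<q k (ℕ.<⇒≤ k<N)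
      where
      open ℕ.≤-Reasoning
      c+k<end : c ℕ.+ k ℕ.< nestEnd (toℕ q)
      c+k<end = begin-strict
        c ℕ.+ k                        <⟨ ℕ.+-monoʳ-< c k<N ⟩
        c ℕ.+ N                        ≡⟨ cong suc (ℕ.+-comm (suc (toℕ r) ℕ.* N) N) ⟩
        1 ℕ.+ suc (suc (toℕ r)) ℕ.* N  ≤⟨ s≤s (ℕ.*-monoˡ-≤ N (s≤s r<q)) ⟩
        nestEnd (toℕ q)                ∎

    -- `r` is used both as a nested interval and as a machine: `plan` puts nested interval `r` on
    -- machine `r`, which is therefore free from time `c` on and takes all short intervals.
    full-plan : (k : ℕ) → Vec (Fin M) (k ℕ.+ (M ℕ.+ m′))
    full-plan k = replicate k r ++ plan

    r-ended : ∀ k j → lookup (full-plan k) j ≡ r → end (lookup (full k) j) ≤ fromℕ (c ℕ.+ k)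
    r-ended zero j planned with index j
    ... | onNest i with trans (sym (plan-nest i)) planned
    ...   | refl rewrite lookup-nest r = fromℕ-mono-≤ (ℕ.≤-reflexive (sym (ℕ.+-identityʳ c)))
    r-ended zero j planned | onUnit i = ℚ.≤-trans (unit-ended i) (fromℕ-mono-≤ (s≤s z≤n))
    r-ended (suc k) zero    _       = fromℕ-mono-≤ (ℕ.≤-reflexive (sym (ℕ.+-suc c k)))
    r-ended (suc k) (suc j) planned = ℚ.≤-trans (r-ended k j planned)
      (fromℕ-mono-≤ (ℕ.+-monoʳ-≤ c (ℕ.n≤1+n k)))

    full-compatible : ∀ k → Compatible (full k) (full-plan k)
    full-compatible zero    = plan-compatible
    full-compatible (suc k) = compatible-∷ (full-compatible k) (r-ended k)

  -- The algorithm facing these instances.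

  module _ (A : OnlineAlgorithm M) (ef1 : SatisfiesEF1 A) where
    open OnlineAlgorithm A using (at-time; feasible; state)

    private
      τ = ALG A base

      τ-occurs : OnlineAlgorithm.Occurs A base τ
      τ-occurs = at-time ordered (arrived-at-horizon base)

    BlockedBase : Fin M → Fin M → Fin M → Set
    BlockedBase r q a = Blocked (fromℕ (nestEnd (toℕ r))) (nested (toℕ q)) a base
                                (state base (fromℕ (nestEnd (toℕ r))))

    -- With more than `M` intervals assigned, some machine holds two. Two nested intervals share the
    -- point 1 and two unit intervals share 0, so the pair is mixed.
    pair-on-machine : M ℕ.< ∣ assigned τ ∣ →
      ∃[ b ] ∃[ r ] ∃[ d ] (lookup τ (r ↑ˡ m′) ≡ just b × lookup τ (M ↑ʳ d) ≡ just b)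
    pair-on-machine M<∣τ∣ with Fin.all? (λ k → ∣ onMachine τ k ∣ ℕ.≤? 1)
    ... | yes ≤1 = contradiction M<∣τ∣
      (ℕ.≤⇒≯ (ℕ.≤-trans (∣assigned∣≤ τ ≤1) (ℕ.≤-reflexive (ℕ.*-identityʳ M))))
    ... | no ¬≤1 with Fin.¬∀⟶∃¬ M _ (λ k → ∣ onMachine τ k ∣ ℕ.≤? 1) ¬≤1
    ... | b , b≰1 with ∣p∣>1⇒∃≢ (onMachine τ b) (ℕ.≰⇒> b≰1)
    ... | x , y , x∈b , y∈b , x≢y
        with index x | index y | ∈-onMachine⁻ τ x∈b | ∈-onMachine⁻ τ y∈b
    ... | onNest i | onUnit j | τx≡b | τy≡b = b , i , j , τx≡b , τy≡b
    ... | onUnit i | onNest j | τx≡b | τy≡b = b , j , i , τy≡b , τx≡b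
    ... | onNest i | onNest j | τx≡b | τy≡b =
      contradiction (nests-overlap i j) (feasible τ-occurs _ _ b x≢y τx≡b τy≡b)
    ... | onUnit i | onUnit j | τx≡b | τy≡b =
      contradiction (units-overlap i j) (feasible τ-occurs _ _ b x≢y τx≡b τy≡b)

    holdsUnit? : ∀ a → Dec (∃[ d ] (lookup τ (M ↑ʳ d) ≡ just a))
    holdsUnit? a = Fin.any? λ d → ≡-dec Fin._≟_ (lookup τ (M ↑ʳ d)) (just a)

    -- There is one unit interval fewer than machines. If every machine held one, two machines would
    -- hold the same one by the pigeonhole principle.
    machine-without-unit : ∃[ a ] (∀ d → lookup τ (M ↑ʳ d) ≢ just a)
    machine-without-unit with Fin.all? holdsUnit?
    ... | yes unitOn with Fin.pigeonhole (ℕ.n<1+n m′) (proj₁ ∘ unitOn)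
    ...   | a , a′ , a<a′ , same = contradiction
            (just-injective (trans (sym (proj₂ (unitOn a)))
              (trans (cong (λ d → lookup τ (M ↑ʳ d)) same) (proj₂ (unitOn a′)))))
            (ℕ.<⇒≢ a<a′ ∘ cong toℕ)
    machine-without-unit | no ¬all with Fin.¬∀⟶∃¬ M _ holdsUnit? ¬all
    ...   | a , none = a , λ d τd≡a → none (d , τd≡a)

    nonempty⇒nest : ∀ {a} → (∀ d → lookup τ (M ↑ʳ d) ≢ just a) → ∃[ j ] (lookup τ j ≡ just a) →
                    ∃[ q ] (lookup τ (q ↑ˡ m′) ≡ just a)
    nonempty⇒nest none (j , τj≡a) with index j
    ... | onNest q = q , τj≡a
    ... | onUnit d = contradiction τj≡a (none d)

    module _ {a b q r d} (none : ∀ d → lookup τ (M ↑ʳ d) ≢ just a)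
             (τq≡a : lookup τ (q ↑ˡ m′) ≡ just a)
             (τr≡b : lookup τ (r ↑ˡ m′) ≡ just b) (τd≡b : lookup τ (M ↑ʳ d) ≡ just b) where
      private
        e  = fromℕ (nestEnd (toℕ r))
        σe = state base e

        T≤e : T ≤ e
        T≤e = fromℕ-mono-≤ (s≤s z≤n)

        e≤horizon : e ≤ horizon base
        e≤horizon = subst (λ x → end x ≤ horizon base) (lookup-nest r)
          (All.lookup⁺ (ended-at-horizon base) (r ↑ˡ m′))

        -- The pair and the machine without a unit interval were found at the horizon, but the short
        -- intervals arrive from `e` on. This step carries those findings back to `e`.
        σe→τ : RevokesAt e base σe τ
        σe→τ = waiting A ef1 ordered (arrived T≤e) e≤horizon

        back : ∀ {j k} → lookup τ j ≡ just k → lookup σe j ≡ just k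
        back = revokes-back {I = base} {σ = σe} {σ′ = τ} σe→τ

        T∈nest : ∀ i → T ∈ᴵ lookup base (i ↑ˡ m′)
        T∈nest i = subst (T ∈ᴵ_) (sym (lookup-nest i)) (T∈nested (toℕ i))

        none-ended : ∀ j → end (lookup base j) ≤ T → lookup τ j ≢ just a
        none-ended j ended with index j
        ... | onNest i = contradiction (ℚ.<-≤-trans (proj₂ (T∈nest i)) ended) (ℚ.<-irrefl refl)
        ... | onUnit i = none i

        -- A unit interval on `a` at `e` has ended and would still be there at the horizon. A second
        -- nested interval would overlap `q`.
        only-q : ∀ j → lookup σe j ≡ just a → j ≡ q ↑ˡ m′
        only-q j σej≡a with index j
        ... | onUnit i = contradiction
          (trans (revokes-keep {I = base} {σ = σe} {σ′ = τ} σe→τ (ℚ.≤-trans (unit-ended i) T≤e)) σej≡a)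
          (none i)
        ... | onNest i with i ↑ˡ m′ Fin.≟ q ↑ˡ m′
        ...   | yes i≡q = i≡q
        ...   | no i≢q  = contradiction (nests-overlap i q)
          (feasible (at-time ordered (arrived T≤e)) _ _ a i≢q σej≡a (back τq≡a))

      r-later : r Fin.< q
      r-later = subst₂ ℕ._<_ (Fin.toℕ-↑ˡ r m′) (Fin.toℕ-↑ˡ q m′)
        (StackedAt.later (stacked-state A ef1 nests nests-start units-end ordered T≤horizon)
          (T∈nest q) (T∈nest r) (unit-ended d) τq≡a τr≡b τd≡b none-ended)

      blocked : BlockedBase r q a
      blocked = record
        { a≢b     = λ where refl → none d τd≡b
        ; r≢d     = nest≢unit r d
        ; Iq≡Q    = lookup-nest q
        ; r-ended = ℚ.≤-reflexive (cong end (lookup-nest r))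
        ; d-ended = ℚ.≤-trans (unit-ended d) T≤e
        ; σq≡a    = back τq≡a
        ; σr≡b    = back τr≡b
        ; σd≡b    = back τd≡b
        ; only-q  = only-q
        }

    ∣ALG∣>M⇒blocked : M ℕ.< ∣ assigned τ ∣ →
                      ∃[ r ] ∃[ q ] ∃[ a ] (r Fin.< q × BlockedBase r q a)
    ∣ALG∣>M⇒blocked M<∣τ∣ =
      let b , r , d , τr≡b , τd≡b = pair-on-machine M<∣τ∣
          a , none = machine-without-unit
          a≢b = λ a≡b → none d (trans τd≡b (cong just (sym a≡b)))
          q , τq≡a = nonempty⇒nest none
            (ef1⇒nonempty {σ = τ} (ef1 τ-occurs) a≢b (nest≢unit r d) τr≡b τd≡b)
      in r , q , a , r-later none τq≡a τr≡b τd≡b , blocked none τq≡a τr≡b τd≡b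

    -- The block persists through all short arrivals, so `a` ends with at most one interval and EF1
    -- allows two on every machine.
    blocked⇒∣ALG∣≤2M : ∀ {r q a} → r Fin.< q →
      BlockedBase r q a → ∣ assigned (ALG A (full r N)) ∣ ℕ.≤ M ℕ.* 2
    blocked⇒∣ALG∣≤2M {r} {q} {a} r<q B = ∣assigned∣≤ (ALG A (full r N))
      (ef1⇒≤2 {σ = ALG A (full r N)} (ef1 (at-time (full-ordered r N) (arrived-at-horizon (full r N))))
        (onlyOne⇒≤1 {σ = ALG A (full r N)} (Blocked.q B′) (Blocked.only-q B′)))
      where
      J = full r N
      e≤horizon : fromℕ (nestEnd (toℕ r)) ≤ horizon J
      -- As `N` is positive there is a last short interval; it starts no earlier than `e` and no
      -- later than the horizon.
      e≤horizon = ℚ.≤-trans (proj₁ (All.head (short-inside r r<q N ℕ.≤-refl)))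
        (All.head (arrived-at-horizon J))
      B′ : Blocked (fromℕ (nestEnd (toℕ r))) (nested (toℕ q)) a J (ALG A J)
      B′ = blocked-state A ef1 (short (nestEnd (toℕ r)) N) (full-ordered r N)
        (arrived (fromℕ-mono-≤ (s≤s z≤n))) (short-inside r r<q N ℕ.≤-refl) B
        e≤horizon (arrived-at-horizon J)

-- Comparing the optimum with the algorithm in both cases.

size-map-just : (f : Vec (Fin m) n) → size (Vec.map just f) ≡ fromℕ n
size-map-just f = trans (k/1≡fromℕ _) (cong fromℕ (∣assigned∣-map-just f))

BeatenBy : ∀ (A : OnlineAlgorithm m) → ℚ → Instance n → Vec (Fin m) n → Set
BeatenBy A α I f = Ordered I × IsOptimal I (Vec.map just f) ×
                   α * size (ALG A I) < size (Vec.map just f)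

beatenBy : ∀ (A : OnlineAlgorithm m) α {I : Instance n} (f : Vec (Fin m) n) → Ordered I →
           Compatible I f → α * fromℕ ∣ assigned (ALG A I) ∣ < fromℕ n → BeatenBy A α I f
beatenBy A α {I} f ordered compatible α*k<n = ordered , compatible⇒optimal {I = I} f compatible ,
  subst₂ _<_ (cong (α *_) (sym (k/1≡fromℕ ∣ assigned (ALG A I) ∣))) (sym (size-map-just f)) α*k<n

module _ {m′ α} (A : OnlineAlgorithm (suc m′)) (ef1 : SatisfiesEF1 A)
         (α<β : α < (+ 2 / 1) - (+ 1 / suc m′)) where
  open Adversary m′

  beaten-base : ∣ assigned (ALG A base) ∣ ℕ.≤ suc m′ → BeatenBy A α base plan
  beaten-base ALG≤m = beatenBy A α plan ordered plan-compatible (α*k<2m-1 {α} {m′} α<β ALG≤m)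

  beaten-full : ∀ {r q a} → r Fin.< q → BlockedBase A ef1 r q a →
                BeatenBy A α (full r (suc m′ ℕ.* 4)) (full-plan r (suc m′ ℕ.* 4))
  beaten-full {r} r<q B = beatenBy A α (full-plan r N) (full-ordered r N) (full-compatible r N)
    (α*k<n {α} {m′} {∣ assigned (ALG A (full r N)) ∣} α<β 2ALG<n)
    where
    N = suc m′ ℕ.* 4
    open ℕ.≤-Reasoning
    ALG≤2m = blocked⇒∣ALG∣≤2M A ef1 r<q B
    2ALG<n : ∣ assigned (ALG A (full r N)) ∣ ℕ.+ ∣ assigned (ALG A (full r N)) ∣ ℕ.<
             N ℕ.+ (suc m′ ℕ.+ m′)
    -- Twice the bound of two per machine is exactly the number `N` of short intervals; the
    -- intervals of `base` make the inequality strict.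
    2ALG<n = begin-strict
      ∣ assigned (ALG A (full r N)) ∣ ℕ.+ ∣ assigned (ALG A (full r N)) ∣  ≤⟨ ℕ.+-mono-≤ ALG≤2m ALG≤2m ⟩
      suc m′ ℕ.* 2 ℕ.+ suc m′ ℕ.* 2  ≡⟨ ℕ.*-distribˡ-+ (suc m′) 2 2 ⟨
      N                              <⟨ ℕ.m<m+n N (s≤s z≤n) ⟩
      N ℕ.+ (suc m′ ℕ.+ m′)          ∎

theorem5 : (m : ℕ) .{{_ : NonZero m}} (A : OnlineAlgorithm m) → SatisfiesEF1 A →
    (α : ℚ) → α < (+ 2 / 1) - (+ 1 / m) →
    ∃[ n ] ∃[ I ] ∃[ OPT ]
    (Ordered {n} I × IsOptimal {n} {m} I OPT × α * size (ALG A I) < size OPT)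
theorem5 (suc m′) A ef1 α α<β = beaten (∣ assigned (ALG A base) ∣ ℕ.≤? suc m′)
  where
  open Adversary m′
  beaten : Dec (∣ assigned (ALG A base) ∣ ℕ.≤ suc m′) →
           ∃[ n ] ∃[ I ] ∃[ OPT ]
           (Ordered {n} I × IsOptimal {n} {suc m′} I OPT × α * size (ALG A I) < size OPT)
  beaten (yes ALG≤m) = _ , _ , _ , beaten-base A ef1 α<β ALG≤m
  beaten (no ALG≰m)  =
    let _ , _ , _ , r<q , B = ∣ALG∣>M⇒blocked A ef1 (ℕ.≰⇒> ALG≰m)
    in _ , _ , _ , beaten-full A ef1 α<β r<q B
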